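{- The relation $\mathtt{Sat}_{\Delta_0}\subseteq\mathbb{N}^2$ is not definable by any $\Delta_0$-formula; that is, there is no $\Delta_0$-formula $\varsigma(x,y)$ such that $\mathtt{Sat}_{\Delta_0}=\{(p,q)\in\mathbb{N}^2 \mid \mathbb{N}\models\varsigma(p,q)\}$.
   Context: $\mathbb{N}$ contains $0$ and also denotes the standard model of arithmetic. Formulas are first-order formulas in the language $\langle 0,1,+,\times,\leqslant\rangle$ with equality and variables $v_0,v_1,v_2,\ldots$. Bounded formulas. A formula is bounded (a $\Delta_0$-formula) if it is constructed from atomic formulas $t=s$, $t\leqslant s$ ($t,s$ terms) by means of negation, conjunction, disjunction, implication and bounded quantifications $\forall x\leqslant t$, $\exists x\leqslant t$, where $t$ is a term in which the variable $x$ does not occur; $\forall x\leqslant t\,\mathcal{A}$ abbreviates $\forall x[x\leqslant t\rightarrow\mathcal{A}]$ and $\exists x\leqslant t\,\mathcal{A}$ abbreviates $\exists x[x\leqslant t\wedge\mathcal{A}]$. Gödel coding. Fix a Gödel coding $\alpha\mapsto\ulcorner\alpha\urcorner\in\mathbb{N}$ of terms and formulas which is primitive recursive in the usual sense: it is injective; the set of codes of variables is primitive recursive and the passages from $i$ to $\ulcorner v_i\urcorner$ and back are primitive recursive; the codes of $t+s$, $t\times s$, $t=s$, $t\leqslant s$, $\neg A$, $A\wedge B$, $A\vee B$, $A\rightarrow B$, $\forall x\leqslant t\,A$, $\exists x\leqslant t\,A$ are given by primitive recursive functions of the codes of the constituents (terms $t,s$, formulas $A,B$, variable $x$), and are strictly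 greater than the codes of these constituents. Satisfaction. $\mathtt{Sat}_{\Delta_0}$ is the set of all ordered pairs $(\ulcorner\theta(\vec\nu)\urcorner,a)$ where $\theta(\vec\nu)$ is a $\Delta_0$-formula with free variables $\vec\nu$, $a\in\mathbb{N}$, and $\mathbb{N}\models\theta(\vec a)$, i.e. the sentence resulting from substituting (the numeral of) the single number $a$ for every free variable of $\theta$ is true in $\mathbb{N}$. -}

module Defs where

open import Data.Bool using (if_then_else_)
open import Data.Empty using (⊥)
open import Data.Fin using (Fin)
open import Data.Maybe using (Maybe; just; nothing; maybe′)
open import Data.Nat using (ℕ; zero; suc; _+_; _*_; _≤_; _<_; _≟_)
open import Data.Product using (∃; ∃-syntax; _×_)
open import Data.Sum using (_⊎_; inj₁; inj₂)
open import Data.Vec using (Vec; []; _∷_; lookup)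
open import Function.Bundles using (_⇔_)
open import Function.Definitions using (Injective)
open import Relation.Binary.PropositionalEquality using (_≡_; _≢_)
open import Relation.Nullary using (¬_; does)

infixl 7 _⊗_
infixl 6 _⊕_
infix  5 _≐_ _≼_
infix  4 ∼_
infixr 3 _∧′_
infixr 2 _∨′_
infixr 1 _⇒_

Var : Set
Var = ℕ

data Term : Set where
  var     : Var → Term
  𝟎 𝟏     : Term
  _⊕_ _⊗_ : Term → Term → Term

data Formula : Set where
  _≐_ _≼_        : Term → Term → Formula
  ∼_             : Formula → Formula
  _∧′_ _∨′_ _⇒_  : Formula → Formula → Formula
  all ex         : Var → Formula → Formula

all≤ ex≤ : Var → Term → Formula → Formula
all≤ x t A = all x (var x ≼ t ⇒ A)
ex≤  x t A = ex x (var x ≼ t ∧′ A)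

_occursIn_ : Var → Term → Set
x occursIn var y   = x ≡ y
x occursIn 𝟎       = ⊥
x occursIn 𝟏       = ⊥
x occursIn (t ⊕ s) = x occursIn t ⊎ x occursIn s
x occursIn (t ⊗ s) = x occursIn t ⊎ x occursIn s

_freeIn_ : Var → Formula → Set
x freeIn (t ≐ s)  = x occursIn t ⊎ x occursIn s
x freeIn (t ≼ s)  = x occursIn t ⊎ x occursIn s
x freeIn (∼ A)    = x freeIn A
x freeIn (A ∧′ B) = x freeIn A ⊎ x freeIn B
x freeIn (A ∨′ B) = x freeIn A ⊎ x freeIn B
x freeIn (A ⇒ B)  = x freeIn A ⊎ x freeIn B
x freeIn all y A  = x ≢ y × x freeIn A
x freeIn ex y A   = x ≢ y × x freeIn A

data Δ₀ : Formula → Set where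
  eq   : ∀ t s → Δ₀ (t ≐ s)
  le   : ∀ t s → Δ₀ (t ≼ s)
  neg  : ∀ {A} → Δ₀ A → Δ₀ (∼ A)
  and  : ∀ {A B} → Δ₀ A → Δ₀ B → Δ₀ (A ∧′ B)
  or   : ∀ {A B} → Δ₀ A → Δ₀ B → Δ₀ (A ∨′ B)
  imp  : ∀ {A B} → Δ₀ A → Δ₀ B → Δ₀ (A ⇒ B)
  ball : ∀ {x t A} → ¬ x occursIn t → Δ₀ A → Δ₀ (all≤ x t A)
  bex  : ∀ {x t A} → ¬ x occursIn t → Δ₀ A → Δ₀ (ex≤ x t A)

numeral : ℕ → Term
numeral zero    = 𝟎
numeral (suc n) = numeral n ⊕ 𝟏

-- A substitution sends each variable to the number whose numeral replaces its
-- free occurrences, or to nothing if they are left alone.  Numerals are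
-- closed, so no variable can be captured.
Subst : Set
Subst = Var → Maybe ℕ

_∖_ : Subst → Var → Subst
(σ ∖ x) y = if does (y ≟ x) then nothing else σ y

substTerm : Subst → Term → Term
substTerm σ (var x) = maybe′ numeral (var x) (σ x)
substTerm σ 𝟎       = 𝟎
substTerm σ 𝟏       = 𝟏
substTerm σ (t ⊕ s) = substTerm σ t ⊕ substTerm σ s
substTerm σ (t ⊗ s) = substTerm σ t ⊗ substTerm σ s

subst : Subst → Formula → Formula
subst σ (t ≐ s)   = substTerm σ t ≐ substTerm σ s
subst σ (t ≼ s)   = substTerm σ t ≼ substTerm σ s
subst σ (∼ A)     = ∼ subst σ A
subst σ (A ∧′ B)  = subst σ A ∧′ subst σ B
subst σ (A ∨′ B)  = subst σ A ∨′ subst σ B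
subst σ (A ⇒ B)   = subst σ A ⇒ subst σ B
subst σ (all x A) = all x (subst (σ ∖ x) A)
subst σ (ex x A)  = ex x (subst (σ ∖ x) A)

everywhere : ℕ → Subst
everywhere a _ = just a

_≔_,_≔_ : Var → ℕ → Var → ℕ → Subst
(x ≔ p , y ≔ q) z =
  if does (z ≟ x) then just p else if does (z ≟ y) then just q else nothing

Assignment : Set
Assignment = Var → ℕ

_[_↦_] : Assignment → Var → ℕ → Assignment
(e [ x ↦ n ]) y = if does (y ≟ x) then n else e y

⟦_⟧ : Term → Assignment → ℕ
⟦ var x ⟧ e = e x
⟦ 𝟎 ⟧     e = 0
⟦ 𝟏 ⟧     e = 1
⟦ t ⊕ s ⟧ e = ⟦ t ⟧ e + ⟦ s ⟧ e
⟦ t ⊗ s ⟧ e = ⟦ t ⟧ e * ⟦ s ⟧ e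

-- Tarski's clauses, with the connectives of the metatheory.  On Δ₀-formulas
-- every clause is decidable, so there this is classical truth in ℕ.
_⊨_ : Assignment → Formula → Set
e ⊨ (t ≐ s)  = ⟦ t ⟧ e ≡ ⟦ s ⟧ e
e ⊨ (t ≼ s)  = ⟦ t ⟧ e ≤ ⟦ s ⟧ e
e ⊨ (∼ A)    = ¬ (e ⊨ A)
e ⊨ (A ∧′ B) = e ⊨ A × e ⊨ B
e ⊨ (A ∨′ B) = e ⊨ A ⊎ e ⊨ B
e ⊨ (A ⇒ B)  = e ⊨ A → e ⊨ B
e ⊨ all x A  = ∀ n → (e [ x ↦ n ]) ⊨ A
e ⊨ ex x A   = ∃[ n ] (e [ x ↦ n ]) ⊨ A

-- Used for sentences, where the choice of assignment is immaterial.
ℕ⊨_ : Formula → Set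
ℕ⊨ A = ∀ e → e ⊨ A

data PR : ℕ → Set where
  zer  : ∀ {n} → PR n
  succ : PR 1
  proj : ∀ {n} → Fin n → PR n
  comp : ∀ {m n} → PR m → Vec (PR n) m → PR n
  rec  : ∀ {n} → PR n → PR (suc (suc n)) → PR (suc n)

mutual
  eval : ∀ {n} → PR n → Vec ℕ n → ℕ
  eval zer         xs           = 0
  eval succ        (x ∷ [])     = suc x
  eval (proj i)    xs           = lookup xs i
  eval (comp f gs) xs           = eval f (evalAll gs xs)
  eval (rec f g)   (zero ∷ xs)  = eval f xs
  eval (rec f g)   (suc n ∷ xs) = eval g (n ∷ eval (rec f g) (n ∷ xs) ∷ xs)

  evalAll : ∀ {m n} → Vec (PR n) m → Vec ℕ n → Vec ℕ m
  evalAll []       xs = []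
  evalAll (g ∷ gs) xs = eval g xs ∷ evalAll gs xs

PrimRecSet : (ℕ → Set) → Set
PrimRecSet P = ∃[ χ ] (∀ n → (P n → eval χ (n ∷ []) ≡ 1)
                           × (¬ P n → eval χ (n ∷ []) ≡ 0))

-- For codings a, b, c of A, B, C: the code of op u v is a primitive recursive
-- function of the codes of u and v, and is greater than both.
Coded₂ : {A B C : Set} → (A → ℕ) → (B → ℕ) → (C → ℕ) → (A → B → C) → Set
Coded₂ a b c op =
    (∃[ f ] (∀ u v → eval f (a u ∷ b v ∷ []) ≡ c (op u v)))
  × (∀ u v → a u < c (op u v) × b v < c (op u v))

record GödelCoding : Set where
  field
    code           : Term ⊎ Formula → ℕ
    code-injective : Injective _≡_ _≡_ code

  ⌜_⌝ᵗ : Term → ℕ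
  ⌜ t ⌝ᵗ = code (inj₁ t)

  ⌜_⌝ : Formula → ℕ
  ⌜ A ⌝ = code (inj₂ A)

  CodedQuantifier : (Var → Term → Formula → Formula) → Set
  CodedQuantifier Q =
      (∃[ f ] (∀ x t A → ¬ x occursIn t →
         eval f (⌜ var x ⌝ᵗ ∷ ⌜ t ⌝ᵗ ∷ ⌜ A ⌝ ∷ []) ≡ ⌜ Q x t A ⌝))
    × (∀ x t A → ¬ x occursIn t →
         ⌜ var x ⌝ᵗ < ⌜ Q x t A ⌝ × ⌜ t ⌝ᵗ < ⌜ Q x t A ⌝ × ⌜ A ⌝ < ⌜ Q x t A ⌝)

  field
    variables-primRec : PrimRecSet (λ n → ∃[ i ] n ≡ ⌜ var i ⌝ᵗ)
    index→code        : ∃[ f ] (∀ i → eval f (i ∷ []) ≡ ⌜ var i ⌝ᵗ)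
    code→index        : ∃[ f ] (∀ i → eval f (⌜ var i ⌝ᵗ ∷ []) ≡ i)

    coded-⊕ : Coded₂ ⌜_⌝ᵗ ⌜_⌝ᵗ ⌜_⌝ᵗ _⊕_
    coded-⊗ : Coded₂ ⌜_⌝ᵗ ⌜_⌝ᵗ ⌜_⌝ᵗ _⊗_
    coded-≐ : Coded₂ ⌜_⌝ᵗ ⌜_⌝ᵗ ⌜_⌝ _≐_
    coded-≼ : Coded₂ ⌜_⌝ᵗ ⌜_⌝ᵗ ⌜_⌝ _≼_

    coded-∼ : (∃[ f ] (∀ A → eval f (⌜ A ⌝ ∷ []) ≡ ⌜ ∼ A ⌝))
            × (∀ A → ⌜ A ⌝ < ⌜ ∼ A ⌝)
    coded-∧ : Coded₂ ⌜_⌝ ⌜_⌝ ⌜_⌝ _∧′_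
    coded-∨ : Coded₂ ⌜_⌝ ⌜_⌝ ⌜_⌝ _∨′_
    coded-⇒ : Coded₂ ⌜_⌝ ⌜_⌝ ⌜_⌝ _⇒_

    coded-all≤ : CodedQuantifier all≤
    coded-ex≤  : CodedQuantifier ex≤

SatΔ₀ : GödelCoding → ℕ → ℕ → Set
SatΔ₀ γ p a = ∃[ θ ] Δ₀ θ × p ≡ ⌜ θ ⌝ × (ℕ⊨ subst (everywhere a) θ)
  where open GödelCoding γ

Δ₀-Definable : (ℕ → ℕ → Set) → Set
Δ₀-Definable R =
  ∃[ x ] ∃[ y ] ∃[ ς ]
    x ≢ y × Δ₀ ς × (∀ z → z freeIn ς → z ≡ x ⊎ z ≡ y)
    × (∀ p q → R p q ⇔ (ℕ⊨ subst (x ≔ p , y ≔ q) ς))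

{-# OPTIONS --safe #-}
-- The liar paradox.  SatΔ₀ substitutes its second argument for every free
-- variable, so ∼ ς(x, y) is already its own diagonalisation: with p = ⌜ ∼ ς ⌝,
-- SatΔ₀ p p says that ς(p, p) is false, whereas definability by ς says that it
-- is true.
module Submission where

open import Defs
open import Data.Bool.Properties using (if-eta)
open import Data.Maybe using (just; nothing)
open import Data.Nat using (ℕ; zero; suc; _+_; _*_; _≤_; _≟_)
open import Data.Nat.Properties using (+-comm)
open import Data.Product using (_×_; _,_)
open import Data.Sum using (_⊎_; inj₁; inj₂; map)
open import Data.Sum.Properties using (inj₂-injective)
open import Function using (_∘_)
open import Function.Bundles using (module Equivalence)
open import Relation.Binary.PropositionalEquality
  using (_≡_; _≢_; refl; sym; trans; cong₂; subst₂)
open import Relation.Nullary using (¬_; yes; no; does)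
open import Relation.Nullary.Decidable using (dec-true; dec-false)

⟦numeral⟧ : ∀ n e → ⟦ numeral n ⟧ e ≡ n
⟦numeral⟧ zero    e = refl
⟦numeral⟧ (suc n) e rewrite ⟦numeral⟧ n e = +-comm n 1

-- Values are compared rather than substitutions, so that a variable replaced by a numeral and one
-- read from the assignment, as bound variables are, count alike.
AgreeOn : (Var → Set) → Subst → Assignment → Subst → Assignment → Set
AgreeOn P σ e τ e′ =
  ∀ z → P z → ⟦ substTerm σ (var z) ⟧ e ≡ ⟦ substTerm τ (var z) ⟧ e′

⟦var⟧-∖-≡ : ∀ σ e x n → ⟦ substTerm (σ ∖ x) (var x) ⟧ (e [ x ↦ n ]) ≡ n
-- The same test is decided twice: once in the substitution, and once in the updated assignment,
-- which it then exposes.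
⟦var⟧-∖-≡ σ e x n rewrite dec-true (x ≟ x) refl | dec-true (x ≟ x) refl = refl

⟦var⟧-∖-≢ : ∀ σ e {x z} n → z ≢ x →
            ⟦ substTerm (σ ∖ x) (var z) ⟧ (e [ x ↦ n ]) ≡ ⟦ substTerm σ (var z) ⟧ e
⟦var⟧-∖-≢ σ e {x} {z} n z≢x rewrite dec-false (z ≟ x) z≢x with σ z
... | just m  = trans (⟦numeral⟧ m _) (sym (⟦numeral⟧ m e))
... | nothing rewrite dec-false (z ≟ x) z≢x = refl

AgreeOn-∖ : ∀ {P σ e τ e′} x n → AgreeOn (λ z → z ≢ x × P z) σ e τ e′ →
            AgreeOn P (σ ∖ x) (e [ x ↦ n ]) (τ ∖ x) (e′ [ x ↦ n ])
AgreeOn-∖ {σ = σ} {e} {τ} {e′} x n agree z Pz with z ≟ x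
... | yes refl = trans (⟦var⟧-∖-≡ σ e z n) (sym (⟦var⟧-∖-≡ τ e′ z n))
... | no z≢x   = trans (⟦var⟧-∖-≢ σ e n z≢x)
                   (trans (agree z (z≢x , Pz)) (sym (⟦var⟧-∖-≢ τ e′ n z≢x)))

⟦substTerm⟧-cong : ∀ {σ e τ e′} t → AgreeOn (_occursIn t) σ e τ e′ →
                   ⟦ substTerm σ t ⟧ e ≡ ⟦ substTerm τ t ⟧ e′
⟦substTerm⟧-cong (var x) agree = agree x refl
⟦substTerm⟧-cong 𝟎       agree = refl
⟦substTerm⟧-cong 𝟏       agree = refl
⟦substTerm⟧-cong (t ⊕ s) agree =
  cong₂ _+_ (⟦substTerm⟧-cong t (λ z → agree z ∘ inj₁)) (⟦substTerm⟧-cong s (λ z → agree z ∘ inj₂))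
⟦substTerm⟧-cong (t ⊗ s) agree =
  cong₂ _*_ (⟦substTerm⟧-cong t (λ z → agree z ∘ inj₁)) (⟦substTerm⟧-cong s (λ z → agree z ∘ inj₂))

-- Induction on `A`. One direction suffices because agreement is symmetric: negations and premises
-- of implications use it reversed.
⊨-subst-resp : ∀ {σ e τ e′} A → AgreeOn (_freeIn A) σ e τ e′ →
               e ⊨ subst σ A → e′ ⊨ subst τ A
⊨-subst-resp (t ≐ s) agree =
  subst₂ _≡_ (⟦substTerm⟧-cong t (λ z → agree z ∘ inj₁)) (⟦substTerm⟧-cong s (λ z → agree z ∘ inj₂))
⊨-subst-resp (t ≼ s) agree =
  subst₂ _≤_ (⟦substTerm⟧-cong t (λ z → agree z ∘ inj₁)) (⟦substTerm⟧-cong s (λ z → agree z ∘ inj₂))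
⊨-subst-resp (∼ A) agree ¬a a = ¬a (⊨-subst-resp A (λ z z∈A → sym (agree z z∈A)) a)
⊨-subst-resp (A ∧′ B) agree (a , b) =
  ⊨-subst-resp A (λ z → agree z ∘ inj₁) a , ⊨-subst-resp B (λ z → agree z ∘ inj₂) b
⊨-subst-resp (A ∨′ B) agree =
  map (⊨-subst-resp A (λ z → agree z ∘ inj₁)) (⊨-subst-resp B (λ z → agree z ∘ inj₂))
⊨-subst-resp (A ⇒ B) agree f a =
  ⊨-subst-resp B (λ z → agree z ∘ inj₂)
    (f (⊨-subst-resp A (λ z z∈A → sym (agree z (inj₁ z∈A))) a))
⊨-subst-resp (all x A) agree h n = ⊨-subst-resp A (AgreeOn-∖ x n agree) (h n)
⊨-subst-resp (ex x A) agree (n , a) = n , ⊨-subst-resp A (AgreeOn-∖ x n agree) a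

≔-diagonal : ∀ {x y z} p → z ≡ x ⊎ z ≡ y → (x ≔ p , y ≔ p) z ≡ just p
≔-diagonal {x} p (inj₁ refl) rewrite dec-true (x ≟ x) refl = refl
-- Both branches of the test against `x` now give `just p`.
≔-diagonal {x} {y} p (inj₂ refl) rewrite dec-true (y ≟ y) refl = if-eta (does (y ≟ x))

theorem2p2 : (γ : GödelCoding) → ¬ Δ₀-Definable (SatΔ₀ γ)
theorem2p2 γ (x , y , ς , _ , Δς , free , defines) = ¬true (Equivalence.to (defines p p) sat)
  where
  open GödelCoding γ

  p : ℕ
  p = ⌜ ∼ ς ⌝

  -- The assignments are arbitrary: every free variable of `ς` becomes the numeral of `p`, whose
  -- value depends on neither.
  agree : ∀ e e′ → AgreeOn (_freeIn ς) (x ≔ p , y ≔ p) e (everywhere p) e′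
  agree e e′ z z∈ς rewrite ≔-diagonal p (free z z∈ς) =
    trans (⟦numeral⟧ p e) (sym (⟦numeral⟧ p e′))

  ¬true : ¬ (ℕ⊨ subst (x ≔ p , y ≔ p) ς)
  ¬true true with Equivalence.from (defines p p) true
  ... | θ , _ , p≡⌜θ⌝ , θ-true with inj₂-injective (code-injective p≡⌜θ⌝)
  -- Injectivity of the coding has made `θ` the formula `∼ ς`, so `θ-true` refutes `ς` at `p`. The
  -- zero assignment is an arbitrary choice.
  ...   | refl = θ-true (λ _ → 0) (⊨-subst-resp ς (agree _ _) (true (λ _ → 0)))

  sat : SatΔ₀ γ p p
  sat = (∼ ς) , neg Δς , refl ,
    -- `¬true` refutes only truth under all assignments, so `s`, given for the single `e`, is
    -- carried to every `e′`.
    λ e s → ¬true (λ e′ → ⊨-subst-resp ς (λ z z∈ς → sym (agree e′ e z z∈ς)) s)
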